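{- Let $\mathbf{C}$ be a small category with countably many arrows, $O$ a set of observations and $T$ an inference system. Let $\mathbf{Coalg}_{\mathbf{H}^I}$ be the full subcategory of $\mathbf{Coalg}_{\mathbf{H}}$ containing the $\mathbf{H}$-coalgebras $\alpha:\mathbb{X}\to\mathbf{H}(\mathbb{X})$ that factor as $\alpha=\alpha';\iota_{\mathbb{X}}$ for some $\Gamma(\mathbf{C})$-homomorphism $\alpha':\mathbb{X}\to\mathbf{S}_T(\mathbb{X})$, where $\iota_{\mathbb{X}}:\mathbf{S}_T(\mathbb{X})\to\mathbf{H}(\mathbb{X})$ is the inclusion. Then $\mathbf{Coalg}_{\mathbf{H}^I}$ has a final object.
   Context: Composition is written in diagrammatic order: $f;g$ means first $f$, then $g$. $|\mathbf{C}|$ is the set of objects and $\|\mathbf{C}\|$ the set of arrows of $\mathbf{C}$. A $\Gamma(\mathbf{C})$-algebra $\mathbb{X}$ is a family of sets $X=(X_i)_{i\in|\mathbf{C}|}$ with a function $c_{\mathbb{X}}:X_i\to X_j$ for every $c\in\mathbf{C}[i,j]$ such that $(id_i)_{\mathbb{X}}=id_{X_i}$ and $(d;e)_{\mathbb{X}}(x)=e_{\mathbb{X}}(d_{\mathbb{X}}(x))$ (i.e. a functor $\mathbf{C}\to\mathbf{Set}$). Homomorphisms are natural transformations; the category is $\mathbf{Alg}_{\Gamma(\mathbf{C})}$. $\int X=\sum_{i}X_i$. $\mathbf{G}(X)_i$ is the set of (at most) countable subsets of $\sum_{j\in|\mathbf{C}|}\mathbf{C}[i,j]\times O\times\int X$.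 The endofunctor $\mathbf{H}$ of $\mathbf{Alg}_{\Gamma(\mathbf{C})}$ maps $\mathbb{X}$ to the algebra with carrier $(\mathbf{G}(X)_i)_i$ and, for $d\in\mathbf{C}[i,k]$, $d_{\mathbf{H}(\mathbb{X})}(A)=\{(c_2,o,x)\mid (c_1,o,x)\in A,\ c_1=d;c_2\}$; on arrows $\mathbf{H}(h)(A)=\{(c,o,h(x))\mid(c,o,x)\in A\}$. An $\mathbf{H}$-coalgebra is $\langle\mathbb{X},\alpha:\mathbb{X}\to\mathbf{H}(\mathbb{X})\rangle$; morphisms $\langle\mathbb{X},\alpha\rangle\to\langle\mathbb{Y},\beta\rangle$ are homomorphisms $f$ with $\alpha;\mathbf{H}(f)=f;\beta$. An inference system $T$ is a set of rules $c\xrightarrow[o']{o}d$ with $c\in\mathbf{C}[i,i']$, $d\in\mathbf{C}[j,j']$, $o,o'\in O$. $\Phi(T)$ is the closure of $T$ together with all identity rules $id_i\xrightarrow[o]{o}id_j$ ($i,j\in|\mathbf{C}|$, $o\in O$) under: $c\xrightarrow[o']{o}c'$ and $d\xrightarrow[o'']{o'}d'$ give $c;d\xrightarrow[o'']{o}c';d'$ whenever $c;d$ and $c';d'$ are defined. For $d\in\mathbf{C}[i,k]$, $c_1$ of source $i$ and $c_2$ of source $k$, write $(c_1,o_1,q_1)\vdash^{d}_{T,\mathbb{X}}(c_2,o_2,q_2)$ iff there are $e,e'\in\|\mathbf{C}\|$ with $c_1;e=d;c_2$, $e\xrightarrow[o_2]{o_1}e'\in\Phi(T)$ and $e'_{\mathbb{X}}(q_1)=q_2$.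 Write $\vdash_{T,\mathbb{X}}$ for $\vdash^{id}_{T,\mathbb{X}}$. $A\in\mathbf{G}(X)_i$ is saturated if closed under $\vdash_{T,\mathbb{X}}$. The endofunctor $\mathbf{S}_T$ maps $\mathbb{X}$ to the algebra whose carrier of sort $i$ is the set of saturated sets in $\mathbf{G}(X)_i$, with $d_{\mathbf{S}_T(\mathbb{X})}(A)=\{t_2\mid \exists t_1\in A,\ t_1\vdash^{d}_{T,\mathbb{X}}t_2\}$; on arrows it acts as $\mathbf{H}$. -}

module Defs where

open import Level using (Level; _⊔_; suc)
open import Data.Nat.Base as ℕ using (ℕ)
open import Data.Nat.Properties using (suc-injective)
open import Data.Product.Base using (Σ; ∃; _×_; _,_; proj₁; proj₂; Σ-syntax; ∃-syntax)
open import Data.Product.Relation.Binary.Pointwise.NonDependent using (×-setoid)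
open import Function.Base using (_∘_)
open import Function.Bundles using (Func; Equivalence; _⇔_; mk⇔; _⟨$⟩_)
open import Relation.Binary.Bundles using (Setoid)
open import Relation.Binary.PropositionalEquality.Core as ≡ using (_≡_; refl; subst)
open import Relation.Unary using (Pred)

private
  variable
    a b e o h ℓ : Level

open Setoid using (Carrier)

-- Sets are setoids.  The hom-sets of the small category and the set of
-- observations live in `Setoid ℓ ℓ`; the carriers of algebras live in
-- `Setoid (suc ℓ) ℓ`, a universe closed under countable subsets.

ΣS : (I : Set a) → (I → Setoid b e) → Setoid (a ⊔ b) (a ⊔ e)
ΣS I F = record
  { Carrier       = Σ I (Carrier ∘ F)
  ; _≈_           = λ (i , x) (j , y) →
                      Σ[ p ∈ i ≡ j ] Setoid._≈_ (F j) (subst (Carrier ∘ F) p x) y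
  ; isEquivalence = record
    { refl  = λ {(i , _)} → refl , Setoid.refl (F i)
    ; sym   = λ { {i , _} (refl , p) → refl , Setoid.sym (F i) p }
    ; trans = λ { {i , _} (refl , p) (refl , q) → refl , Setoid.trans (F i) p q }
    }
  }

-- A (at most) countable subset of S is the range of a partial function
-- ℕ ⇀ S.  The partial function has an arbitrary (not necessarily
-- decidable) domain, and two subsets are equal when they have the same
-- elements.

record CountableSubset {a e} (ℓ : Level) (S : Setoid a e) : Set (a ⊔ e ⊔ suc ℓ) where
  open Setoid S using (_≈_)
  field
    Dom        : Pred ℕ ℓ
    at         : ∀ {n} → Dom n → Carrier S
    functional : ∀ {n} (p q : Dom n) → at p ≈ at q

open CountableSubset public using (Dom; at; functional)

module _ {S : Setoid a e} where
  open Setoid S using (_≈_)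

  infix 4 _∈_ _⊆_

  _∈_ : Carrier S → CountableSubset ℓ S → Set (e ⊔ ℓ)
  s ∈ A = ∃[ n ] Σ[ p ∈ Dom A n ] at A p ≈ s

  -- Equivalent to `∀ s → s ∈ A → s ∈ B` (see `⊆⇒` and `⇒⊆`), but stays
  -- in the level of equality.
  _⊆_ : CountableSubset ℓ S → CountableSubset ℓ S → Set (e ⊔ ℓ)
  A ⊆ B = ∀ {n} (p : Dom A n) → at A p ∈ B

  ∈-resp : (A : CountableSubset ℓ S) → ∀ {s t} → s ≈ t → s ∈ A → t ∈ A
  ∈-resp A s≈t (n , p , q) = n , p , Setoid.trans S q s≈t

  at-∈ : (A : CountableSubset ℓ S) → ∀ {n} (p : Dom A n) → at A p ∈ A
  at-∈ A p = _ , p , Setoid.refl S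

  ⊆⇒ : (A B : CountableSubset ℓ S) → A ⊆ B → ∀ s → s ∈ A → s ∈ B
  ⊆⇒ A B A⊆B s (n , p , q) = ∈-resp B q (A⊆B p)

  ⇒⊆ : (A B : CountableSubset ℓ S) → (∀ s → s ∈ A → s ∈ B) → A ⊆ B
  ⇒⊆ A B f p = f _ (at-∈ A p)

  -- { s ∈ B ∣ P s }
  separate : CountableSubset ℓ S → (Carrier S → Set ℓ) → CountableSubset ℓ S
  separate B P = record
    { Dom        = λ n → Σ[ p ∈ Dom B n ] P (at B p)
    ; at         = λ (p , _) → at B p
    ; functional = λ (p , _) (q , _) → functional B p q
    }

𝒫ω : (ℓ : Level) → Setoid a e → Setoid (a ⊔ e ⊔ suc ℓ) (e ⊔ ℓ)
𝒫ω ℓ S = record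
  { Carrier       = CountableSubset ℓ S
  ; _≈_           = λ A B → A ⊆ B × B ⊆ A
  ; isEquivalence = record
    { refl  = λ {A} → at-∈ A , at-∈ A
    ; sym   = λ (p , q) → q , p
    ; trans = λ {A} {B} {D} (p , q) (p′ , q′) →
                (λ x → ⊆⇒ B D p′ _ (p x)) , (λ x → ⊆⇒ B A q _ (q′ x))
    }
  }

image : {S : Setoid a e} {S′ : Setoid b e} → Func S S′ →
        CountableSubset ℓ S → CountableSubset ℓ S′
image f A = record
  { Dom        = Dom A
  ; at         = λ p → f ⟨$⟩ at A p
  ; functional = λ p q → Func.cong f (functional A p q)
  }

Countable : Setoid a e → Set (a ⊔ suc e)
Countable {e = e} S = Σ[ A ∈ CountableSubset e S ] ∀ s → s ∈ A

-- (a , b) ↦ 2ᵃ (2b + 1)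
double : ℕ → ℕ
double ℕ.zero    = ℕ.zero
double (ℕ.suc n) = ℕ.suc (ℕ.suc (double n))

pair : ℕ → ℕ → ℕ
pair ℕ.zero    n = ℕ.suc (double n)
pair (ℕ.suc m) n = double (pair m n)

double-injective : ∀ m n → double m ≡ double n → m ≡ n
double-injective ℕ.zero    ℕ.zero    _ = refl
double-injective (ℕ.suc m) (ℕ.suc n) p =
  ≡.cong ℕ.suc (double-injective m n (suc-injective (suc-injective p)))

odd≢even : ∀ m n {A : Set a} → ℕ.suc (double m) ≡ double n → A
odd≢even ℕ.zero    (ℕ.suc ℕ.zero)    ()
odd≢even ℕ.zero    (ℕ.suc (ℕ.suc n)) ()
odd≢even (ℕ.suc m) (ℕ.suc n)         p  =
  odd≢even m n (suc-injective (suc-injective p))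

pair-injective : ∀ m n m′ n′ → pair m n ≡ pair m′ n′ → m ≡ m′ × n ≡ n′
pair-injective ℕ.zero    n ℕ.zero     n′ p = refl , double-injective n n′ (suc-injective p)
pair-injective ℕ.zero    n (ℕ.suc m′) n′ p = odd≢even n (pair m′ n′) p
pair-injective (ℕ.suc m) n ℕ.zero     n′ p = odd≢even n′ (pair m n) (≡.sym p)
pair-injective (ℕ.suc m) n (ℕ.suc m′) n′ p
  with refl , q ← pair-injective m n m′ n′ (double-injective _ _ p) = refl , q

-- Composition f ⨾ g is in diagrammatic order: first f, then g.

record Category (o h e : Level) : Set (suc (o ⊔ h ⊔ e)) where
  infixr 9 _⨾_
  infix 4 _≈_
  field
    Obj : Set o
    Hom : Obj → Obj → Setoid h e

  Arr : Obj → Obj → Set h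
  Arr i j = Carrier (Hom i j)

  _≈_ : ∀ {i j} → Arr i j → Arr i j → Set e
  _≈_ {i} {j} = Setoid._≈_ (Hom i j)

  field
    id        : ∀ i → Arr i i
    _⨾_       : ∀ {i j k} → Arr i j → Arr j k → Arr i k
    ⨾-cong    : ∀ {i j k} {f f′ : Arr i j} {g g′ : Arr j k} →
                f ≈ f′ → g ≈ g′ → f ⨾ g ≈ f′ ⨾ g′
    identityˡ : ∀ {i j} (f : Arr i j) → id i ⨾ f ≈ f
    identityʳ : ∀ {i j} (f : Arr i j) → f ⨾ id j ≈ f
    assoc     : ∀ {i j k l} (f : Arr i j) (g : Arr j k) (h : Arr k l) →
                (f ⨾ g) ⨾ h ≈ f ⨾ (g ⨾ h)

  module HomEq {i j} = Setoid (Hom i j) using (refl; sym; trans)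

arrows : Category o h e → Setoid (o ⊔ h) (o ⊔ e)
arrows C = ΣS (Obj × Obj) (λ (i , j) → Hom i j)
  where open Category C

record Functor {o h e o′ h′ e′} (C : Category o h e) (D : Category o′ h′ e′) :
               Set (o ⊔ h ⊔ e ⊔ o′ ⊔ h′ ⊔ e′) where
  private
    module C = Category C
    module D = Category D
  field
    F₀       : C.Obj → D.Obj
    F₁       : ∀ {X Y} → C.Arr X Y → D.Arr (F₀ X) (F₀ Y)
    F-cong   : ∀ {X Y} {f g : C.Arr X Y} → f C.≈ g → F₁ f D.≈ F₁ g
    F-id     : ∀ X → F₁ (C.id X) D.≈ D.id (F₀ X)
    F-⨾      : ∀ {X Y Z} (f : C.Arr X Y) (g : C.Arr Y Z) →
               F₁ (f C.⨾ g) D.≈ F₁ f D.⨾ F₁ g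

record FinalObject (C : Category o h e) : Set (o ⊔ h ⊔ e) where
  open Category C
  field
    ⊤        : Obj
    !        : ∀ X → Arr X ⊤
    !-unique : ∀ {X} (f : Arr X ⊤) → f ≈ ! X

FullSubcategory : (C : Category o h e) → Pred (Category.Obj C) ℓ → Category (o ⊔ ℓ) h e
FullSubcategory C P = record
  { Obj       = Σ Obj P
  ; Hom       = λ (X , _) (Y , _) → Hom X Y
  ; id        = λ (X , _) → id X
  ; _⨾_       = _⨾_
  ; ⨾-cong    = ⨾-cong
  ; identityˡ = identityˡ
  ; identityʳ = identityʳ
  ; assoc     = assoc
  }
  where open Category C

module _ {C : Category o h e} (F : Functor C C) where
  open Category C
  open Functor F

  record Coalgebra : Set (o ⊔ h) where
    constructor ⟨_,_⟩
    field
      X : Obj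
      α : Arr X (F₀ X)

  open Coalgebra

  IsCoalgebraMorphism : (𝕏 𝕐 : Coalgebra) → Arr (X 𝕏) (X 𝕐) → Set e
  IsCoalgebraMorphism 𝕏 𝕐 f = α 𝕏 ⨾ F₁ f ≈ f ⨾ α 𝕐

  Coalg : Category (o ⊔ h) (h ⊔ e) e
  Coalg = record
    { Obj       = Coalgebra
    ; Hom       = λ 𝕏 𝕐 → record
      { Carrier       = Σ (Arr (X 𝕏) (X 𝕐)) (IsCoalgebraMorphism 𝕏 𝕐)
      ; _≈_           = λ (f , _) (g , _) → f ≈ g
      ; isEquivalence = record
        { refl = HomEq.refl ; sym = HomEq.sym ; trans = HomEq.trans }
      }
    ; id        = λ 𝕏 → id (X 𝕏) ,
        HomEq.trans (⨾-cong HomEq.refl (F-id _))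
          (HomEq.trans (identityʳ _) (HomEq.sym (identityˡ _)))
    ; _⨾_       = λ (f , p) (g , q) → f ⨾ g ,
        HomEq.trans (⨾-cong HomEq.refl (F-⨾ f g))
          (HomEq.trans (HomEq.sym (assoc _ _ _))
          (HomEq.trans (⨾-cong p HomEq.refl)
          (HomEq.trans (assoc _ _ _)
          (HomEq.trans (⨾-cong HomEq.refl q) (HomEq.sym (assoc _ _ _))))))
    ; ⨾-cong    = ⨾-cong
    ; identityˡ = λ (f , _) → identityˡ f
    ; identityʳ = λ (f , _) → identityʳ f
    ; assoc     = λ (f , _) (g , _) (h , _) → assoc f g h
    }

module _ {ℓ} (C : Category ℓ ℓ ℓ) where
  open Category C

  record Algebra : Set (suc (suc ℓ)) where
    field
      Sort : Obj → Setoid (suc ℓ) ℓ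

    infix 4 _≋_
    _≋_ : ∀ {i} → Carrier (Sort i) → Carrier (Sort i) → Set ℓ
    _≋_ {i} = Setoid._≈_ (Sort i)

    field
      op      : ∀ {i j} → Arr i j → Func (Sort i) (Sort j)
      op-resp : ∀ {i j} {c d : Arr i j} → c ≈ d → ∀ x → op c ⟨$⟩ x ≋ op d ⟨$⟩ x
      op-id   : ∀ {i} x → op (id i) ⟨$⟩ x ≋ x
      op-⨾    : ∀ {i j k} (d : Arr i j) (e : Arr j k) x →
                op (d ⨾ e) ⟨$⟩ x ≋ op e ⟨$⟩ (op d ⟨$⟩ x)

    module SortEq {i} = Setoid (Sort i) using (refl; sym; trans)

  ∫ : Algebra → Setoid (suc ℓ) ℓ
  ∫ X = ΣS Obj (Algebra.Sort X)

  record Homomorphism (X Y : Algebra) : Set (suc ℓ) where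
    private
      module X = Algebra X
      module Y = Algebra Y
    field
      map     : ∀ {i} → Func (X.Sort i) (Y.Sort i)
      natural : ∀ {i j} (c : Arr i j) x →
                map ⟨$⟩ (X.op c ⟨$⟩ x) Y.≋ Y.op c ⟨$⟩ (map ⟨$⟩ x)

  open Homomorphism

  Alg : Category (suc (suc ℓ)) (suc ℓ) (suc ℓ)
  Alg = record
    { Obj       = Algebra
    ; Hom       = λ X Y → let open Algebra Y using (_≋_; module SortEq) in record
      { Carrier       = Homomorphism X Y
      ; _≈_           = λ f g → ∀ {i} (x : Carrier (Algebra.Sort X i)) →
                          map f ⟨$⟩ x ≋ map g ⟨$⟩ x
      ; isEquivalence = record
        { refl  = λ _ → SortEq.refl
        ; sym   = λ p x → SortEq.sym (p x)
        ; trans = λ p q x → SortEq.trans (p x) (q x)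
        }
      }
    ; id        = λ X → let open Algebra X using (module SortEq) in record
      { map     = record { to = λ x → x ; cong = λ p → p }
      ; natural = λ _ _ → SortEq.refl
      }
    ; _⨾_       = λ {X} {Y} {Z} f g → let open Algebra Z using (module SortEq) in record
      { map     = record
        { to   = λ x → map g ⟨$⟩ (map f ⟨$⟩ x)
        ; cong = λ p → Func.cong (map g) (Func.cong (map f) p)
        }
      ; natural = λ c x → SortEq.trans (Func.cong (map g) (natural f c x)) (natural g c _)
      }
    ; ⨾-cong    = λ {_} {_} {Z} {_} {_} {g} p q x →
                    Algebra.SortEq.trans Z (Func.cong (map g) (p x)) (q _)
    ; identityˡ = λ {_} {Y} _ _ → Algebra.SortEq.refl Y
    ; identityʳ = λ {_} {Y} _ _ → Algebra.SortEq.refl Y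
    ; assoc     = λ {_} {_} {_} {W} _ _ _ _ → Algebra.SortEq.refl W
    }

module _ {ℓ} (C : Category ℓ ℓ ℓ) (countable : Countable (arrows C)) (O : Setoid ℓ ℓ) where
  open Category C
  open Homomorphism
  open Equivalence using (to; from)

  private
    module O = Setoid O
    module Alg = Category (Alg C)

  Triple : Algebra C → Obj → Setoid (suc ℓ) ℓ
  Triple X i = ΣS Obj (λ j → ×-setoid (Hom i j) (×-setoid O (∫ C X)))

  G : Algebra C → Obj → Setoid (suc ℓ) ℓ
  G X i = 𝒫ω ℓ (Triple X i)

  private
    code : ∀ {i j} → Arr i j → ℕ
    code c = proj₁ (proj₂ countable (_ , c))

    code-injective : ∀ {i j k} (c : Arr i j) (d : Arr i k) → code c ≡ code d →
                     Setoid._≈_ (ΣS Obj (Hom i)) (j , c) (k , d)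
    code-injective c d p
      with proj₂ countable (_ , c) | proj₂ countable (_ , d)
    code-injective c d refl | n , p , p≈c | .n , q , q≈d
      with refl , r ← Setoid.trans (arrows C) (Setoid.sym (arrows C) p≈c)
                       (Setoid.trans (arrows C) (functional (proj₁ countable) p q) q≈d)
      = refl , r

  module _ (X : Algebra C) where

    private
      module T {i} = Setoid (Triple X i)

    -- { (c₂ , o , x) ∣ (c₁ , o , x) ∈ A , c₁ = d ⨾ c₂ }.  The element
    -- obtained from the n-th element of A and c₂ has number
    -- pair n (code c₂).
    H-act : ∀ {i k} → Arr i k → CountableSubset ℓ (Triple X i) → CountableSubset ℓ (Triple X k)
    H-act {i} {k} d A = record
      { Dom        = λ n → ∃[ m ] Σ[ p ∈ Dom A m ]
                       let (j , c₁ , _) = at A p in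
                       Σ[ c₂ ∈ Arr k j ] c₁ ≈ d ⨾ c₂ × pair m (code c₂) ≡ n
      ; at         = λ (_ , p , c₂ , _) → let (j , _ , ox) = at A p in j , c₂ , ox
      ; functional = λ (m , p , c , _ , r) (m′ , p′ , c′ , _ , r′) →
                       aux p p′ c c′ (pair-injective m (code c) m′ (code c′) (≡.trans r (≡.sym r′)))
      }
      where
      lem : ∀ {t t′ : Carrier (Triple X i)} (let (j , _ , ox) = t) (let (j′ , _ , ox′) = t′)
            (c : Arr k j) (c′ : Arr k j′) →
            t T.≈ t′ → code c ≡ code c′ → (j , c , ox) T.≈ (j′ , c′ , ox′)
      lem c c′ (refl , _ , ox≈) q with refl , c≈c′ ← code-injective c c′ q = refl , c≈c′ , ox≈

      aux : ∀ {m m′} (p : Dom A m) (p′ : Dom A m′)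
            (c : Arr k (proj₁ (at A p))) (c′ : Arr k (proj₁ (at A p′))) →
            m ≡ m′ × code c ≡ code c′ →
            (_ , c , proj₂ (proj₂ (at A p))) T.≈ (_ , c′ , proj₂ (proj₂ (at A p′)))
      aux p p′ c c′ (refl , q) = lem c c′ (functional A p p′) q

    ∈-H-act : ∀ {i k} (d : Arr i k) A {j} {c : Arr k j} {ox} →
              (j , c , ox) ∈ H-act d A ⇔ (j , d ⨾ c , ox) ∈ A
    ∈-H-act d A = mk⇔
      (λ where (_ , (m , p , c₂ , c₁≈ , _) , refl , c₂≈ , ox≈) →
                 m , p , refl , HomEq.trans c₁≈ (⨾-cong HomEq.refl c₂≈) , ox≈)
      (λ (m , p , t≈) → aux p t≈)
      where
      lem : ∀ t {j c ox} → t T.≈ (j , d ⨾ c , ox) →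
            let (j₁ , c₁ , ox₁) = t in
            Σ[ c₂ ∈ Arr _ j₁ ] c₁ ≈ d ⨾ c₂ × (j₁ , c₂ , ox₁) T.≈ (j , c , ox)
      lem t {c = c} (refl , c≈ , ox≈) = c , c≈ , refl , HomEq.refl , ox≈

      aux : ∀ {m} (p : Dom A m) {j c ox} → at A p T.≈ (j , d ⨾ c , ox) →
             (j , c , ox) ∈ H-act d A
      aux p t≈ with c₂ , c₁≈ , r ← lem (at A p) t≈ = _ , (_ , p , c₂ , c₁≈ , refl) , r

    H-act-mono : ∀ {i k} (d : Arr i k) {A B} → A ⊆ B → H-act d A ⊆ H-act d B
    H-act-mono d {A} {B} A⊆B = ⇒⊆ (H-act d A) (H-act d B) λ t →
      from (∈-H-act d B) ∘ ⊆⇒ A B A⊆B _ ∘ to (∈-H-act d A)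

    H₀ : Algebra C
    H₀ = record
      { Sort    = G X
      ; op      = λ d → record
        { to   = H-act d
        ; cong = λ {A} {B} (p , q) → H-act-mono d {A} {B} p , H-act-mono d {B} {A} q
        }
      ; op-resp = λ c≈d A → resp c≈d A , resp (HomEq.sym c≈d) A
      ; op-id   = λ A →
          ⇒⊆ (H-act (id _) A) A
            (λ _ → ∈-resp A (refl , identityˡ _ , Setoid.refl oxS) ∘ to (∈-H-act _ A)) ,
          ⇒⊆ A (H-act (id _) A)
            (λ _ → from (∈-H-act _ A) ∘ ∈-resp A (refl , HomEq.sym (identityˡ _) , Setoid.refl oxS))
      ; op-⨾    = λ d e A →
          ⇒⊆ (H-act (d ⨾ e) A) (H-act e (H-act d A))
            (λ _ → from (∈-H-act e (H-act d A)) ∘ from (∈-H-act d A) ∘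
                   ∈-resp A (refl , assoc _ _ _ , Setoid.refl oxS) ∘ to (∈-H-act _ A)) ,
          ⇒⊆ (H-act e (H-act d A)) (H-act (d ⨾ e) A)
            (λ _ → from (∈-H-act _ A) ∘
                   ∈-resp A (refl , HomEq.sym (assoc _ _ _) , Setoid.refl oxS) ∘
                   to (∈-H-act d A) ∘ to (∈-H-act e (H-act d A)))
      }
      where
      oxS = ×-setoid O (∫ C X)

      resp : ∀ {i k} {c d : Arr i k} → c ≈ d → ∀ A → H-act c A ⊆ H-act d A
      resp {c = c} {d} c≈d A = ⇒⊆ (H-act c A) (H-act d A) λ _ →
        from (∈-H-act d A) ∘
        ∈-resp A (refl , ⨾-cong c≈d HomEq.refl , Setoid.refl oxS) ∘
        to (∈-H-act c A)

  Triple-map : ∀ {X Y} → Homomorphism C X Y → ∀ {i} → Func (Triple X i) (Triple Y i)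
  Triple-map h = record
    { to   = λ (j , c , o , k , x) → j , c , o , k , map h ⟨$⟩ x
    ; cong = λ where (refl , c≈ , o≈ , refl , x≈) →
                       refl , c≈ , o≈ , refl , Func.cong (map h) x≈
    }

  private
    Triple-map-cong : ∀ {X Y} (f g : Homomorphism C X Y) → f Alg.≈ g → ∀ {i} t →
                      Setoid._≈_ (Triple Y i) (Triple-map f ⟨$⟩ t) (Triple-map g ⟨$⟩ t)
    Triple-map-cong _ _ f≈g (_ , _ , _ , _ , x) = refl , HomEq.refl , O.refl , refl , f≈g x

  H-map : ∀ {X Y} → Homomorphism C X Y → ∀ {i} → Func (G X i) (G Y i)
  H-map h = record
    { to   = image (Triple-map h)
    ; cong = λ {A} {B} (p , q) → mono {A} {B} p , mono {B} {A} q
    }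
    where
    mono : ∀ {A B} → A ⊆ B → image (Triple-map h) A ⊆ image (Triple-map h) B
    mono A⊆B p with m , q , r ← A⊆B p = m , q , Func.cong (Triple-map h) r

  H : Functor (Alg C) (Alg C)
  H = record
    { F₀     = H₀
    ; F₁     = λ {X} {Y} h → record
      { map     = H-map h
      ; natural = λ c A →
          Setoid.refl (G Y _) {x = H-act Y c (image (Triple-map h) A)}
      }
    ; F-cong = λ {X} {Y} {f} {g} f≈g A →
        (λ p → _ , p , Triple-map-cong g f (λ x → Algebra.SortEq.sym Y (f≈g x)) (at A p)) ,
        (λ p → _ , p , Triple-map-cong f g f≈g (at A p))
    ; F-id   = λ X A → Setoid.refl (G X _) {x = A}
    ; F-⨾    = λ {X} {Y} {Z} f g A →
        Setoid.refl (G Z _) {x = image (Triple-map g) (image (Triple-map f) A)}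
    }

module _ {ℓ} (C : Category ℓ ℓ ℓ) (O : Setoid ℓ ℓ) where
  open Category C

  private
    module O = Setoid O

  record Rule : Set ℓ where
    constructor _—[_/_]→_
    field
      {i i′ j j′} : Obj
      c           : Arr i i′
      above below : Carrier O
      d           : Arr j j′

  InferenceSystem : Set (suc ℓ)
  InferenceSystem = Pred Rule ℓ

  -- In c —[ o / o′ ]→ d, o is written above the arrow and o′ below.
  -- Arrows and observations are compared by setoid equality; `resp`
  -- makes Φ T invariant under it, so T itself need not be.
  data Φ (T : InferenceSystem) : Pred Rule ℓ where
    rule     : ∀ {r} → T r → Φ T r
    identity : ∀ i j o → Φ T (id i —[ o / o ]→ id j)
    compose  : ∀ {i i′ i″ j j′ j″ o o′ o″}
               {c : Arr i i′} {c′ : Arr j j′} {d : Arr i′ i″} {d′ : Arr j′ j″} →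
               Φ T (c —[ o / o′ ]→ c′) → Φ T (d —[ o′ / o″ ]→ d′) →
               Φ T ((c ⨾ d) —[ o / o″ ]→ (c′ ⨾ d′))
    resp     : ∀ {i i′ j j′ o₁ o₂ o₁′ o₂′} {c₁ c₂ : Arr i i′} {d₁ d₂ : Arr j j′} →
               c₁ ≈ c₂ → o₁ O.≈ o₂ → o₁′ O.≈ o₂′ → d₁ ≈ d₂ →
               Φ T (c₁ —[ o₁ / o₁′ ]→ d₁) → Φ T (c₂ —[ o₂ / o₂′ ]→ d₂)

module _ {ℓ} (C : Category ℓ ℓ ℓ) (countable : Countable (arrows C)) (O : Setoid ℓ ℓ)
         (T : InferenceSystem C O) where
  open Category C
  open Homomorphism
  open Equivalence using (to; from)

  private
    module O = Setoid O
    module Alg = Category (Alg C)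
    module H = Functor (H C countable O)

    𝕋 : Algebra C → Obj → Setoid (suc ℓ) ℓ
    𝕋 = Triple C countable O

    G-sym : ∀ X {i} (A B : CountableSubset ℓ (𝕋 X i)) →
            Setoid._≈_ (G C countable O X i) A B → Setoid._≈_ (G C countable O X i) B A
    G-sym X {i} A B = Setoid.sym (G C countable O X i) {A} {B}

    G-trans : ∀ X {i} (A B D : CountableSubset ℓ (𝕋 X i)) →
              Setoid._≈_ (G C countable O X i) A B → Setoid._≈_ (G C countable O X i) B D →
              Setoid._≈_ (G C countable O X i) A D
    G-trans X {i} A B D = Setoid.trans (G C countable O X i) {A} {B} {D}

    _—[_/_]⇒_ : ∀ {i i′ j j′} → Arr i i′ → Carrier O → Carrier O → Arr j j′ → Set ℓ
    c —[ o / o′ ]⇒ d = Φ C O T (c —[ o / o′ ]→ d)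

  module _ (X : Algebra C) where
    open Algebra X using (Sort; op; op-id; _≋_; module SortEq)

    private
      module G {i} = Setoid (G C countable O X i)
      module T {i} = Setoid (𝕋 X i)

      act : ∀ {i k} → Arr i k → CountableSubset ℓ (𝕋 X i) → CountableSubset ℓ (𝕋 X k)
      act = H-act C countable O X

      ∈-act : ∀ {i k} (d : Arr i k) A {j} {c : Arr k j} {ox} →
              (j , c , ox) ∈ act d A ⇔ (j , d ⨾ c , ox) ∈ A
      ∈-act = ∈-H-act C countable O X

      act-cong : ∀ {i k} (d : Arr i k) {A B} → A G.≈ B → act d A G.≈ act d B
      act-cong d {A} {B} = Func.cong (Algebra.op (H.F₀ X) d) {A} {B}

    infix 4 _⊢[_]_

    _⊢[_]_ : ∀ {i k} → Carrier (𝕋 X i) → Arr i k → Carrier (𝕋 X k) → Set ℓ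
    (j₁ , c₁ , o₁ , k₁ , q₁) ⊢[ d ] (j₂ , c₂ , o₂ , k₂ , q₂) =
      Σ[ e ∈ Arr j₁ j₂ ] Σ[ e′ ∈ Arr k₁ k₂ ]
        c₁ ⨾ e ≈ d ⨾ c₂ × e —[ o₁ / o₂ ]⇒ e′ × op e′ ⟨$⟩ q₁ ≋ q₂

    Saturated : ∀ {i} → CountableSubset ℓ (𝕋 X i) → Set (suc ℓ)
    Saturated {i} A = ∀ {t₁ t₂} → t₁ ∈ A → t₁ ⊢[ id i ] t₂ → t₂ ∈ A

    ⊢-resp : ∀ {i k} {d : Arr i k} {t₁ t₁′ t₂ t₂′} → t₁ T.≈ t₁′ → t₂ T.≈ t₂′ →
             t₁ ⊢[ d ] t₂ → t₁′ ⊢[ d ] t₂′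
    ⊢-resp (refl , c₁≈ , o₁≈ , refl , q₁≈) (refl , c₂≈ , o₂≈ , refl , q₂≈)
           (e , e′ , p , r , q) =
      e , e′ ,
      HomEq.trans (⨾-cong (HomEq.sym c₁≈) HomEq.refl)
        (HomEq.trans p (⨾-cong HomEq.refl c₂≈)) ,
      resp HomEq.refl o₁≈ o₂≈ HomEq.refl r ,
      SortEq.trans (Func.cong (op e′) (SortEq.sym q₁≈)) (SortEq.trans q q₂≈)

    -- { t₂ ∣ ∃ t₁ ∈ A , t₁ ⊢ᵈ t₂ }, see `∈-S-act`.  For saturated A this
    -- set is included in act d A, hence countable.
    S-act : ∀ {i k} → Arr i k → CountableSubset ℓ (𝕋 X i) → CountableSubset ℓ (𝕋 X k)
    S-act d A = separate (act d A) (λ t₂ → ∃[ n ] Σ[ p ∈ Dom A n ] at A p ⊢[ d ] t₂)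

    private
      ⊢⇒∈-act : ∀ {i k} (d : Arr i k) {A} → Saturated A →
                ∀ {t₁ t₂} → t₁ ∈ A → t₁ ⊢[ d ] t₂ → t₂ ∈ act d A
      ⊢⇒∈-act d {A} sat t₁∈A (e , e′ , p , r , q) =
        from (∈-act d A) (sat t₁∈A (e , e′ , HomEq.trans p (HomEq.sym (identityˡ _)) , r , q))

      ∈-act⇒⊢ : ∀ {i k} (d : Arr i k) {A} → ∀ {t₂} → t₂ ∈ act d A →
                ∃ λ t₁ → t₁ ∈ A × t₁ ⊢[ d ] t₂
      ∈-act⇒⊢ d {A} t₂∈ =
        _ , to (∈-act d A) t₂∈ , id _ , id _ , identityʳ _ , identity _ _ _ , op-id _

    ∈-S-act : ∀ {i k} (d : Arr i k) A → Saturated A →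
              ∀ {t₂} → t₂ ∈ S-act d A ⇔ (∃ λ t₁ → t₁ ∈ A × t₁ ⊢[ d ] t₂)
    ∈-S-act d A sat = mk⇔
      (λ (_ , (_ , _ , p , r) , s) → at A p , at-∈ A p , ⊢-resp T.refl s r)
      (λ (t₁ , (n , p , q) , r) →
        let (m , p′ , s) = ⊢⇒∈-act d {A} sat (n , p , q) r
        in  m , (p′ , n , p , ⊢-resp (T.sym q) (T.sym s) r) , s)

    private
      S-act≈act : ∀ {i k} (d : Arr i k) A → Saturated A → S-act d A G.≈ act d A
      S-act≈act d A sat =
        (λ (p , _) → at-∈ (act d A) p) ,
        (λ p → from (∈-S-act d A sat) (∈-act⇒⊢ d {A} (at-∈ (act d A) p)))

      saturated-resp : ∀ {i} (A B : CountableSubset ℓ (𝕋 X i)) → A G.≈ B → Saturated A → Saturated B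
      saturated-resp A B (A⊆B , B⊆A) sat t₁∈B r =
        ⊆⇒ A B A⊆B _ (sat (⊆⇒ B A B⊆A _ t₁∈B) r)

      act-saturated : ∀ {i k} (d : Arr i k) A → Saturated A → Saturated (act d A)
      act-saturated d A sat t₁∈ (e , e′ , p , r , q) =
        from (∈-act d A) (sat (to (∈-act d A) t₁∈)
          ( e , e′
          , HomEq.trans (assoc _ _ _) (HomEq.trans (⨾-cong HomEq.refl (HomEq.trans p (identityˡ _)))
              (HomEq.sym (identityˡ _)))
          , r , q))

    S-act-saturated : ∀ {i k} (d : Arr i k) A → Saturated A → Saturated (S-act d A)
    S-act-saturated d A sat =
      saturated-resp (act d A) (S-act d A)
        (G-sym X (S-act d A) (act d A) (S-act≈act d A sat)) (act-saturated d A sat)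

    S₀ : Algebra C
    S₀ = record
      { Sort    = λ i → record
        { Carrier       = Σ (CountableSubset ℓ (𝕋 X i)) Saturated
        ; _≈_           = λ (A , _) (B , _) → A G.≈ B
        ; isEquivalence = record
          { refl  = λ {(A , _)} → G.refl {x = A}
          ; sym   = λ {(A , _)} {(B , _)} → G-sym X A B
          ; trans = λ {(A , _)} {(B , _)} {(D , _)} → G-trans X A B D
          }
        }
      ; op      = λ d → record
        { to   = λ (A , sat) → S-act d A , S-act-saturated d A sat
        ; cong = λ {(A , satA)} {(B , satB)} A≈B →
            G-trans X (S-act d A) (act d A) (S-act d B) (S-act≈act d A satA)
              (G-trans X (act d A) (act d B) (S-act d B) (act-cong d {A} {B} A≈B)
                (G-sym X (S-act d B) (act d B) (S-act≈act d B satB)))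
        }
      ; op-resp = λ {_} {_} {c} {d} c≈d (A , sat) →
          G-trans X (S-act c A) (act c A) (S-act d A) (S-act≈act c A sat)
            (G-trans X (act c A) (act d A) (S-act d A) (Algebra.op-resp (H.F₀ X) c≈d A)
              (G-sym X (S-act d A) (act d A) (S-act≈act d A sat)))
      ; op-id   = λ (A , sat) →
          G-trans X (S-act (id _) A) (act (id _) A) A (S-act≈act (id _) A sat)
            (Algebra.op-id (H.F₀ X) A)
      ; op-⨾    = λ d e (A , sat) →
          let B = act d A ; B′ = S-act d A in
          G-trans X (S-act (d ⨾ e) A) (act (d ⨾ e) A) (S-act e B′) (S-act≈act (d ⨾ e) A sat)
            (G-trans X (act (d ⨾ e) A) (act e B) (S-act e B′) (Algebra.op-⨾ (H.F₀ X) d e A)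
              (G-sym X (S-act e B′) (act e B)
                (G-trans X (S-act e B′) (act e B′) (act e B)
                  (S-act≈act e B′ (S-act-saturated d A sat))
                  (act-cong e {B′} {B} (S-act≈act d A sat)))))
      }

    ι : Homomorphism C S₀ (H.F₀ X)
    ι = record
      { map     = record { to = proj₁ ; cong = λ p → p }
      ; natural = λ d (A , sat) → S-act≈act d A sat
      }

  image-saturated : ∀ {X Y} (h : Homomorphism C X Y) {i} (A : CountableSubset ℓ (𝕋 X i)) →
                    Saturated X A → Saturated Y (image (Triple-map C countable O h) A)
  image-saturated {X} {Y} h {i} A sat {t₁} {t₂} (n , p , q) r =
    aux (at A p) (at-∈ A p) (⊢-resp Y (Setoid.sym (𝕋 Y i) q) (Setoid.refl (𝕋 Y i)) r)
    where
    f = Triple-map C countable O h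

    aux : ∀ t {t₂} → t ∈ A → _⊢[_]_ Y (f ⟨$⟩ t) (id i) t₂ → t₂ ∈ image f A
    aux (_ , _ , _ , _ , x) t∈A (e , e′ , p , r , q)
      with m , p′ , s ← sat t∈A (e , e′ , p , r , Algebra.SortEq.refl X)
      = m , p′ , Setoid.trans (𝕋 Y i) (Func.cong f s)
          (refl , HomEq.refl , O.refl , refl , Algebra.SortEq.trans Y (natural h e′ x) q)

  S : Functor (Alg C) (Alg C)
  S = record
    { F₀     = S₀
    ; F₁     = λ {X} {Y} h → record
      { map     = record
        { to   = λ (A , sat) → image (f h) A , image-saturated h A sat
        ; cong = λ {(A , _)} {(B , _)} → Func.cong (map (H.F₁ h)) {A} {B}
        }
      ; natural = λ d (A , sat) → S-natural h d A sat
      }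
    ; F-cong = λ {_} {_} {f} {g} f≈g (A , _) → H.F-cong {f = f} {g} f≈g A
    ; F-id   = λ X (A , _) → H.F-id X A
    ; F-⨾    = λ f g (A , _) → H.F-⨾ f g A
    }
    where
    f : ∀ {X Y} → Homomorphism C X Y → ∀ {i} → Func (𝕋 X i) (𝕋 Y i)
    f = Triple-map C countable O

    S-natural : ∀ {X Y} (h : Homomorphism C X Y) {i k} (d : Arr i k) A → Saturated X A →
                Setoid._≈_ (G C countable O Y k) (image (f h) (S-act X d A)) (S-act Y d (image (f h) A))
    S-natural {X} {Y} h {i} {k} d A sat =
      G-trans Y (image (f h) (S-act X d A)) (image (f h) (H-act C countable O X d A)) (S-act Y d (image (f h) A))
        (Func.cong (map (H.F₁ h)) {S-act X d A} {H-act C countable O X d A} (natural (ι X) d (A , sat)))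
        (G-sym Y (S-act Y d (image (f h) A)) (H-act C countable O Y d (image (f h) A))
          (natural (ι Y) d (image (f h) A , image-saturated h A sat)))

  FactorsThroughS : Pred (Coalgebra (H C countable O)) (suc ℓ)
  FactorsThroughS ⟨ X , α ⟩ =
    Σ[ α′ ∈ Alg.Arr X (Functor.F₀ S X) ] α Alg.≈ α′ Alg.⨾ ι X

  CoalgHᴵ : Category (suc (suc ℓ)) (suc ℓ) (suc ℓ)
  CoalgHᴵ = FullSubcategory (Coalg (H C countable O)) FactorsThroughS

{-# OPTIONS --safe #-}
module Submission where

-- An H-coalgebra is a multi-sorted transition system on ∫X together with an
-- arbitrary algebra structure: naturality says that the transitions of an
-- instance of x are determined by those of x.  The final object consists of
-- pointed small transition systems, up to bisimilarity, all of whose states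
-- are saturated; the unique morphism sends x to the system of finite paths
-- starting at x.  Saturation passes to this system because it is bisimilar
-- to x.  Bisimilarity has to live in the level of equality, so it is
-- built as a greatest fixed point of small approximations.

open import Level using (Level; _⊔_; suc)
open import Data.Nat.Base using (ℕ)
open import Data.Product.Base using (Σ; ∃; _×_; _,_; proj₁; proj₂; Σ-syntax; ∃-syntax; map₂)
open import Data.Sum.Base using (_⊎_; inj₁; inj₂)
open import Data.Unit.Polymorphic.Base using (⊤; tt)
open import Function.Base using (_∘_)
open import Function.Bundles using (Func; Equivalence; _⟨$⟩_)
open import Relation.Binary.Bundles using (Setoid)
open import Relation.Binary.PropositionalEquality.Core as ≡ using (_≡_; refl; subst)
open import Defs

open Setoid using (Carrier)

-- Small greatest fixed points.

-- Elements are coherent sequences of finite approximations, compared position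
-- by position, so neither function extensionality nor guarded corecursion is
-- needed.
module GreatestFixedPoint
  {a ℓ} {I : Set a} (Shape Position : I → Set ℓ)
  (next : ∀ {i} → Shape i → Position i → I)
  where

  private
    Approx : ℕ → I → Set ℓ
    Approx ℕ.zero    i = ⊤
    Approx (ℕ.suc n) i = Σ[ s ∈ Shape i ] ∀ p → Approx n (next s p)

    transport : ∀ n {i} {s s′ : Shape i} {p} → s ≡ s′ →
                Approx n (next s p) → Approx n (next s′ p)
    transport n {p = p} = subst (λ s → Approx n (next s p))

    Restricts : ∀ n {i} → Approx (ℕ.suc n) i → Approx n i → Set ℓ
    Restricts ℕ.zero    _       _         = ⊤
    Restricts (ℕ.suc n) (s , f) (s′ , f′) =
      Σ[ e ∈ s ≡ s′ ] ∀ p → Restricts n (transport (ℕ.suc n) e (f p)) (f′ p)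

    restricts-transport : ∀ n {i} {s s′ s″ : Shape i} {p} (e : s ≡ s′) (e′ : s′ ≡ s″) {w w′} →
      Restricts n (transport (ℕ.suc n) e w) w′ →
      Restricts n {next s″ p} (transport (ℕ.suc n) (≡.trans e e′) w) (transport n e′ w′)
    restricts-transport n refl refl r = r

  record ν (i : I) : Set ℓ where
    constructor limit
    field
      approximant : ∀ n → Approx n i
      restriction : ∀ n → Restricts n (approximant (ℕ.suc n)) (approximant n)

  out : ∀ {i} → ν i → Σ[ s ∈ Shape i ] ∀ p → ν (next s p)
  -- All nontrivial approximants share the shape of approximant 1, and the `n`-th approximant of a
  -- child is read off the `n + 1`-st of its parent.
  out {i} (limit w r) = shape 0 , λ p → limit
    (λ n → transport n (e n) (proj₂ (w (ℕ.suc n)) p))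
    (λ n → restricts-transport n (proj₁ (r (ℕ.suc n))) (e n) (proj₂ (r (ℕ.suc n)) p))
    where
    shape : ∀ n → Shape i
    shape n = proj₁ (w (ℕ.suc n))

    e : ∀ n → shape n ≡ shape 0
    e ℕ.zero    = refl
    e (ℕ.suc n) = ≡.trans (proj₁ (r (ℕ.suc n))) (e n)

  module _ {b} (R : I → Set b)
           (step : ∀ {i} → R i → Σ[ s ∈ Shape i ] ∀ p → R (next s p)) where

    private
      approx : ∀ n {i} → R i → Approx n i
      approx ℕ.zero    _ = tt
      approx (ℕ.suc n) r = let (s , f) = step r in s , λ p → approx n (f p)

      restricts : ∀ n {i} (r : R i) → Restricts n (approx (ℕ.suc n) r) (approx n r)
      restricts ℕ.zero    _ = tt
      restricts (ℕ.suc n) r = refl , λ p → restricts n (proj₂ (step r) p)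

    -- `R` may be large although `ν` is small: an approximant records only the shapes that `step`
    -- produces, never the witnesses of `R`.
    coinduction : ∀ {i} → R i → ν i
    coinduction r = limit (λ n → approx n r) (λ n → restricts n r)

-- Labelled graphs and bisimilarity.

module Bisimulation {ℓ} (C : Category ℓ ℓ ℓ) (O : Setoid ℓ ℓ) where
  open Category C
  private module O = Setoid O

  Labelled : ∀ {a} → (Obj → Set a) → Obj → Set (ℓ ⊔ a)
  Labelled N i = Σ[ j ∈ Obj ] Arr i j × Carrier O × Σ Obj N

  -- Nodes may be large, but branching is small; hence bisimilarity is small.
  record Graph (a : Level) : Set (suc (ℓ ⊔ a)) where
    field
      Node   : Obj → Set a
      Branch : ∀ {i} → Node i → Set ℓ
      target : ∀ {i} (x : Node i) → Branch x → Labelled Node i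

  open Graph

  Rel : ∀ {a a′} → (Obj → Set a) → (Obj → Set a′) → ∀ b → Set (ℓ ⊔ a ⊔ a′ ⊔ suc b)
  Rel N N′ b = ∀ {k} → N k → N′ k → Set b

  module _ {a a′} {N : Obj → Set a} {N′ : Obj → Set a′} where

    -- Stated between two node families so that behaviours can later be compared with elements of an
    -- arbitrary algebra.
    record Match {b} (R : Rel N N′ b) {i} (t : Labelled N i) (t′ : Labelled N′ i) : Set (ℓ ⊔ b) where
      constructor match
      private
        j = proj₁ t ; c = proj₁ (proj₂ t) ; o = proj₁ (proj₂ (proj₂ t))
        k = proj₁ (proj₂ (proj₂ (proj₂ t))) ; x = proj₂ (proj₂ (proj₂ (proj₂ t)))
        j′ = proj₁ t′ ; c′ = proj₁ (proj₂ t′) ; o′ = proj₁ (proj₂ (proj₂ t′))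
        k′ = proj₁ (proj₂ (proj₂ (proj₂ t′))) ; x′ = proj₂ (proj₂ (proj₂ (proj₂ t′)))
      field
        target≡  : j ≡ j′
        sort≡    : k ≡ k′
        arrow≈   : subst (Arr i) target≡ c ≈ c′
        output≈  : o O.≈ o′
        related  : R (subst N sort≡ x) x′

    Match-map : ∀ {b b′} (R : Rel N N′ b) (R′ : Rel N N′ b′) →
                (∀ {k} {x : N k} {x′ : N′ k} → R x x′ → R′ x x′) →
                ∀ {i} {t : Labelled N i} {t′ : Labelled N′ i} → Match R t t′ → Match R′ t t′
    Match-map R R′ f (match p q c≈ o≈ r) = match p q c≈ o≈ (f r)

  module _ {a a′} {N : Obj → Set a} {N′ : Obj → Set a′} where

    Match-flip : ∀ {b} (R : Rel N N′ b) {i} {t : Labelled N i} {t′ : Labelled N′ i} →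
                 Match R t t′ → Match {N = N′} {N} (λ x′ x → R x x′) t′ t
    Match-flip R {t = _ , _ , _ , _ , _} {_ , _ , _ , _ , _} (match refl refl c≈ o≈ r) =
      match refl refl (HomEq.sym c≈) (O.sym o≈) r

  module _ {a a′ a″} {N : Obj → Set a} {N′ : Obj → Set a′} {N″ : Obj → Set a″} where

    Match-compose :
      ∀ {b b′} (R : Rel N N′ b) (R′ : Rel N′ N″ b′) →
      ∀ {i} {t : Labelled N i} {t′ : Labelled N′ i} {t″ : Labelled N″ i} →
      Match R t t′ → Match R′ t′ t″ → Match {N = N} {N″} (λ x z → ∃ λ y → R x y × R′ y z) t t″
    Match-compose R R′ {t = _ , _ , _ , _ , _} {_ , _ , _ , _ , _} {_ , _ , _ , _ , _}
      (match refl refl c≈ o≈ r) (match refl refl c≈′ o≈′ r′) =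
      match refl refl (HomEq.trans c≈ c≈′) (O.trans o≈ o≈′) (_ , r , r′)

  module _ {a a′} (M : Graph a) (M′ : Graph a′) where

    Step : ∀ {b} → Rel (Node M) (Node M′) b → Rel (Node M) (Node M′) (ℓ ⊔ b)
    Step R x x′ =
      (∀ b → ∃ λ (b′ : Branch M′ x′) → Match R (target M x b) (target M′ x′ b′)) ×
      (∀ b′ → ∃ λ (b : Branch M x) → Match R (target M x b) (target M′ x′ b′))

    private
      Pair : Set (ℓ ⊔ a ⊔ a′)
      Pair = Σ[ k ∈ Obj ] Node M k × Node M′ k

      Always : Rel (Node M) (Node M′) ℓ
      Always _ _ = ⊤

      successors : ∀ {i} {t : Labelled (Node M) i} {t′ : Labelled (Node M′) i} →
                   Match Always t t′ → Pair
      successors {t = _ , _ , _ , _ , x} {_ , _ , _ , k′ , x′} m =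
        k′ , subst (Node M) (Match.sort≡ m) x , x′

      -- One round of the bisimulation game: a plan answers every branch of either side, checking
      -- labels only, and a position is a challenge. Plans are small because branching is, and
      -- `Bisimilar` consists of strategies that never get stuck.
      Plan Position : Pair → Set ℓ
      Plan     (_ , x , x′) = Step Always x x′
      Position (_ , x , x′) = Branch M x ⊎ Branch M′ x′

      next : ∀ {i} → Plan i → Position i → Pair
      next (f , g) (inj₁ b)  = successors (proj₂ (f b))
      next (f , g) (inj₂ b′) = successors (proj₂ (g b′))

      open GreatestFixedPoint Plan Position (λ {i} → next {i})

    Bisimilar : Rel (Node M) (Node M′) ℓ
    Bisimilar x x′ = ν (_ , x , x′)

    private
      attach : ∀ {b} (R : Rel (Node M) (Node M′) b)
               {i} {t : Labelled (Node M) i} {t′ : Labelled (Node M′) i}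
               (m : Match Always t t′) → (let (_ , x , x′) = successors m in R x x′) → Match R t t′
      attach R (match p q c≈ o≈ _) r = match p q c≈ o≈ r

    unfold : ∀ {k} {x : Node M k} {x′ : Node M′ k} → Bisimilar x x′ → Step Bisimilar x x′
    unfold r with (f , g) , h ← out r =
      (λ b → proj₁ (f b) , attach Bisimilar (proj₂ (f b)) (h (inj₁ b))) ,
      (λ b′ → proj₁ (g b′) , attach Bisimilar (proj₂ (g b′)) (h (inj₂ b′)))

    coinduct : ∀ {b} (R : Rel (Node M) (Node M′) b) →
               (∀ {k} {x : Node M k} {x′ : Node M′ k} → R x x′ → Step R x x′) →
               ∀ {k} {x : Node M k} {x′ : Node M′ k} → R x x′ → Bisimilar x x′
    coinduct R step = coinduction (λ (_ , x , x′) → R x x′) λ r →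
      let (f , g) = step r in
      ( map₂ (Match-map R Always _) ∘ f
      , map₂ (Match-map R Always _) ∘ g ) ,
      λ { (inj₁ b)  → Match.related (proj₂ (f b))
        ; (inj₂ b′) → Match.related (proj₂ (g b′)) }

    Step-map : ∀ {b b′} (R : Rel (Node M) (Node M′) b) (R′ : Rel (Node M) (Node M′) b′) →
               (∀ {k} {x : Node M k} {x′ : Node M′ k} → R x x′ → R′ x x′) →
               ∀ {k} {x : Node M k} {x′ : Node M′ k} → Step R x x′ → Step R′ x x′
    Step-map R R′ h (f , g) = map₂ (Match-map R R′ h) ∘ f , map₂ (Match-map R R′ h) ∘ g

    -- Lambek's argument: `unfold` and monotonicity of `Step` make `Step Bisimilar` a post-fixed
    -- point of `Step`.
    fold : ∀ {k} {x : Node M k} {x′ : Node M′ k} → Step Bisimilar x x′ → Bisimilar x x′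
    fold = coinduct (Step Bisimilar) (Step-map Bisimilar (Step Bisimilar) unfold)

  -- Equivalence laws of bisimilarity.

  Bisimilar-refl : ∀ {a} (M : Graph a) {k} {x : Node M k} → Bisimilar M M x x
  Bisimilar-refl M = coinduct M M _≡_ (λ { refl → (λ b → b , same) , (λ b → b , same) }) refl
    where
    same : ∀ {i} {t : Labelled (Node M) i} → Match _≡_ t t
    same = match refl refl HomEq.refl O.refl refl

  Bisimilar-sym : ∀ {a a′} (M : Graph a) (M′ : Graph a′) {k} {x : Node M k} {x′ : Node M′ k} →
                  Bisimilar M M′ x x′ → Bisimilar M′ M x′ x
  Bisimilar-sym M M′ r = coinduct M′ M (λ x′ x → Bisimilar M M′ x x′)
    (λ r → let (f , g) = unfold M M′ r in
      map₂ (Match-flip (Bisimilar M M′)) ∘ g , map₂ (Match-flip (Bisimilar M M′)) ∘ f)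
    r

  Bisimilar-trans :
    ∀ {a a′ a″} (M : Graph a) (M′ : Graph a′) (M″ : Graph a″) →
    ∀ {k} {x : Node M k} {x′ : Node M′ k} {x″ : Node M″ k} →
    Bisimilar M M′ x x′ → Bisimilar M′ M″ x′ x″ → Bisimilar M M″ x x″
  Bisimilar-trans M M′ M″ r r′ =
    coinduct M M″ (λ x z → ∃ λ y → Bisimilar M M′ x y × Bisimilar M′ M″ y z)
      (λ (_ , r , r′) →
        let (f , g) = unfold M M′ r ; (f′ , g′) = unfold M′ M″ r′ in
        (λ b → let (b′ , m) = f b ; (b″ , m′) = f′ b′ in b″ , ⨾-match m m′) ,
        (λ b″ → let (b′ , m′) = g′ b″ ; (b , m) = g b′ in b , ⨾-match m m′))
      (_ , r , r′)
    where
    ⨾-match = Match-compose (Bisimilar M M′) (Bisimilar M′ M″)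

-- Behaviours of small systems and their formal action.

module FinalCoalgebra {ℓ} (C : Category ℓ ℓ ℓ) (countable : Countable (arrows C)) (O : Setoid ℓ ℓ)
                      (T : InferenceSystem C O) where
  open Category C
  open Bisimulation C O
  open Graph
  open Homomorphism
  open Equivalence using (to; from)

  private
    module O = Setoid O
    module Alg = Category (Alg C)
    module H = Functor (H C countable O)

    𝕋 : Algebra C → Obj → Setoid (suc ℓ) ℓ
    𝕋 = Triple C countable O

    infix 4 _⊢_⇒_

    _⊢_⇒_ : ∀ {i i′ j j′} → Carrier O × Carrier O → Arr i i′ → Arr j j′ → Set ℓ
    (o , o′) ⊢ e ⇒ e′ = Φ C O T (e —[ o / o′ ]→ e′)

  -- Numbering the transitions lets a state present a countable subset, and small state sets keep
  -- the collection of all systems within the level of algebra carriers.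
  record System : Set (suc ℓ) where
    field
      State   : Set ℓ
      sort    : State → Obj
      Enabled : State → ℕ → Set ℓ
      step    : ∀ s {n} → Enabled s n → Σ[ j ∈ Obj ] Arr (sort s) j × Carrier O × State

  open System

  -- (S , s , d) stands for the state s of S acted upon by d.  Keeping d
  -- formal makes the action total without adding states to S.
  Behaviour : Obj → Set (suc ℓ)
  Behaviour k = Σ[ S ∈ System ] Σ[ s ∈ State S ] Arr (sort S s) k

  state : (S : System) (s : State S) → Behaviour (sort S s)
  state S s = S , s , id _

  act : ∀ {k l} → Arr k l → Behaviour k → Behaviour l
  act e (S , s , d) = S , s , d ⨾ e

  transition : ∀ S s {n} → Enabled S s n → Labelled Behaviour (sort S s)
  transition S s p = let (j , c , o , s′) = step S s p in j , c , o , sort S s′ , state S s′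

  -- The condition `c₁ ≈ d ⨾ c₂` is the one by which `d` acts in `H`, so a formal instance has the
  -- transitions that naturality demands.
  behaviours : Graph (suc ℓ)
  behaviours = record
    { Node   = Behaviour
    ; Branch = λ {k} (S , s , d) → ∃[ n ] Σ[ p ∈ Enabled S s n ]
                 let (j , c₁ , _) = transition S s p in Σ[ c₂ ∈ Arr k j ] c₁ ≈ d ⨾ c₂
    ; target = λ (S , s , d) (_ , p , c₂ , _) → let (j , _ , ox) = transition S s p in j , c₂ , ox
    }

  infix 4 _∼_

  _∼_ : ∀ {k} → Behaviour k → Behaviour k → Set ℓ
  _∼_ = Bisimilar behaviours behaviours

  private
    ∼-refl : ∀ {k} {z : Behaviour k} → z ∼ z
    ∼-refl = Bisimilar-refl behaviours

    ∼-sym : ∀ {k} {z z′ : Behaviour k} → z ∼ z′ → z′ ∼ z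
    ∼-sym = Bisimilar-sym behaviours behaviours

    ∼-trans : ∀ {k} {z z′ z″ : Behaviour k} → z ∼ z′ → z′ ∼ z″ → z ∼ z″
    ∼-trans = Bisimilar-trans behaviours behaviours behaviours

    Match-sym : ∀ {i} {t t′ : Labelled Behaviour i} → Match _∼_ t t′ → Match _∼_ t′ t
    Match-sym m = Match-map (λ x y → y ∼ x) _∼_ ∼-sym (Match-flip _∼_ m)

    Match-trans : ∀ {i} {t t′ t″ : Labelled Behaviour i} →
                  Match _∼_ t t′ → Match _∼_ t′ t″ → Match _∼_ t t″
    Match-trans m m′ = Match-map _ _∼_ (λ (_ , r , r′) → ∼-trans r r′) (Match-compose _∼_ _∼_ m m′)

  act-resp : ∀ {S s k} {d d′ : Arr (sort S s) k} → d ≈ d′ → (S , s , d) ∼ (S , s , d′)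
  act-resp d≈d′ = fold behaviours behaviours
    ( (λ (n , p , c , q) → (n , p , c , HomEq.trans q (⨾-cong d≈d′ HomEq.refl)) , same)
    , (λ (n , p , c , q) → (n , p , c , HomEq.trans q (⨾-cong (HomEq.sym d≈d′) HomEq.refl)) , same))
    where
    same : ∀ {i} {t : Labelled Behaviour i} → Match _∼_ t t
    same = match refl refl HomEq.refl O.refl ∼-refl

  private
    Match-factor :
      ∀ {a a′ b} {N : Obj → Set a} {N′ : Obj → Set a′} (R : Rel N N′ b) {k l} {e : Arr k l}
        {j c ox} {t′ : Labelled N′ k} (let (j′ , c′ , ox′) = t′) →
      Match R (j , e ⨾ c , ox) t′ →
      Σ[ c″ ∈ Arr l j′ ] e ⨾ c″ ≈ c′ × Match R (j , c , ox) (j′ , c″ , ox′)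
    Match-factor R {c = c} {t′ = _ , _ , _ , _ , _} (match refl q c≈ o≈ r) =
      c , c≈ , match refl q HomEq.refl o≈ r

  -- A branch `c` of `act e z` is the branch `e ⨾ c` of `z`; the answer of `z′` has an equal arrow,
  -- so it factors through `e` again.
  act-cong : ∀ {k l} (e : Arr k l) {z z′ : Behaviour k} → z ∼ z′ → act e z ∼ act e z′
  act-cong e z∼z′ = fold behaviours behaviours
    ( simulate z∼z′
    , λ b → let (b′ , m) = simulate (∼-sym z∼z′) b in b′ , Match-sym m )
    where
    simulate : ∀ {z z′} → z ∼ z′ → (b : Branch behaviours (act e z)) →
               ∃ λ b′ → Match _∼_ (target behaviours (act e z) b) (target behaviours (act e z′) b′)
    simulate {S , s , d} {S′ , s′ , d′} z∼z′ (n , p , c , q) =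
      let ((n′ , p′ , c′ , q′) , m) = proj₁ (unfold behaviours behaviours z∼z′)
                                        (n , p , e ⨾ c , HomEq.trans q (assoc d e c))
          (c″ , e⨾c″≈c′ , m″) = Match-factor _∼_ m
      in  (n′ , p′ , c″ , HomEq.trans q′ (HomEq.trans (⨾-cong HomEq.refl (HomEq.sym e⨾c″≈c′))
                                           (HomEq.sym (assoc d′ e c″)))) , m″

  -- Valid systems and their algebra.

  record Valid (S : System) : Set ℓ where
    field
      -- Different proofs of one number may lead to different states, so agreement is asked only up
      -- to `∼`; this yields `functional` for `transitions`.
      deterministic : ∀ s {n} (p q : Enabled S s n) → Match _∼_ (transition S s p) (transition S s q)
      -- Saturation of `transitions S`, in a form that does not mention the
      -- algebra 𝔹, whose elements have to be valid.
      closed : ∀ s {n} (p : Enabled S s n) (let (j , c , o , k , z) = transition S s p)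
               {j′ k′ o′} {e : Arr j j′} {e′ : Arr k k′} → (o , o′) ⊢ e ⇒ e′ →
               ∃[ m ] Σ[ q ∈ Enabled S s m ]
                 Match _∼_ (j′ , c ⨾ e , o′ , k′ , act e′ z) (transition S s q)

  open Valid

  𝔹 : Algebra C
  𝔹 = record
    { Sort    = λ k → record
      { Carrier       = Σ[ z ∈ Behaviour k ] Valid (proj₁ z)
      ; _≈_           = λ (z , _) (z′ , _) → z ∼ z′
      ; isEquivalence = record { refl = ∼-refl ; sym = ∼-sym ; trans = ∼-trans }
      }
    ; op      = λ e → record
      { to   = λ (z , v) → act e z , v
      ; cong = act-cong e
      }
    ; op-resp = λ c≈d _ → act-resp (⨾-cong HomEq.refl c≈d)
    ; op-id   = λ ((_ , _ , d) , _) → act-resp (identityʳ d)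
    ; op-⨾    = λ e e′ ((_ , _ , d) , _) → act-resp (HomEq.sym (assoc d e e′))
    }

  -- The saturated coalgebra of valid behaviours.

  private
    forget : ∀ {i} → Carrier (𝕋 𝔹 i) → Labelled Behaviour i
    forget (j , c , o , k , z , _) = j , c , o , k , z

    Match⇒≈ : ∀ {i} (t t′ : Carrier (𝕋 𝔹 i)) → Match _∼_ (forget t) (forget t′) →
              Setoid._≈_ (𝕋 𝔹 i) t t′
    Match⇒≈ (_ , _ , _ , _ , _) (_ , _ , _ , _ , _) (match refl refl c≈ o≈ r) =
      refl , c≈ , o≈ , refl , r

    ≈⇒Match : ∀ {i} (t t′ : Carrier (𝕋 𝔹 i)) → Setoid._≈_ (𝕋 𝔹 i) t t′ →
              Match _∼_ (forget t) (forget t′)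
    ≈⇒Match (_ , _ , _ , _ , _) (_ , _ , _ , _ , _) (refl , c≈ , o≈ , refl , r) =
      match refl refl c≈ o≈ r

  -- Validity concerns the whole system, so the proof for a state also serves its successors.
  member : ∀ {S} → Valid S → ∀ s {n} → Enabled S s n → Carrier (𝕋 𝔹 (sort S s))
  member {S} v s p = let (j , c , o , k , z) = transition S s p in j , c , o , k , z , v

  transitions : ∀ S → Valid S → ∀ s → CountableSubset ℓ (𝕋 𝔹 (sort S s))
  transitions S v s = record
    { Dom        = Enabled S s
    ; at         = member v s
    ; functional = λ p q → Match⇒≈ (member v s p) (member v s q) (deterministic v s p q)
    }

  β : ∀ {k} → Carrier (Algebra.Sort 𝔹 k) → CountableSubset ℓ (𝕋 𝔹 k)
  β ((S , s , d) , v) = H-act C countable O 𝔹 d (transitions S v s)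

  β-mono : ∀ {k} {z z′ : Carrier (Algebra.Sort 𝔹 k)} → proj₁ z ∼ proj₁ z′ → β z ⊆ β z′
  β-mono {z = z} {z′} z∼z′ b@(n , p , c , q , _)
    with (n′ , p′ , c′ , q′) , m ← proj₁ (unfold behaviours behaviours z∼z′) (n , p , c , q)
    = _ , b′ , Match⇒≈ (at (β z′) b′) (at (β z) b) (Match-sym m)
    where b′ = n′ , p′ , c′ , q′ , refl

  𝔹-structure : Homomorphism C 𝔹 (H.F₀ 𝔹)
  𝔹-structure = record
    { map     = record
      { to   = β
      ; cong = λ {z} {z′} r → β-mono {z = z} {z′} r , β-mono {z = z′} {z} (∼-sym r)
      }
    -- `act e` appends `e` to the `d` through which `β` acts, so naturality is functoriality of the
    -- action in `H`.
    ; natural = λ e ((S , s , d) , v) → Algebra.op-⨾ (H.F₀ 𝔹) d e (transitions S v s)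
    }

  -- `closed` treats consequences of the literal form `c ⨾ e`, `act e′ z`; by the definition of `⊢`
  -- any other consequence is equal to such a triple.
  transitions-saturated : ∀ S v s → Saturated C countable O T 𝔹 (transitions S v s)
  transitions-saturated S v s {t₁} {t₂@(j₂ , _ , o₂ , k₂ , _)} (_ , p , t≈) t₁⊢t₂ =
    let A = transitions S v s
        (_ , c , _ , _ , z , _) = at A p
        (e , e′ , ce≈ , r , q) = ⊢-resp C countable O T 𝔹 {t₁ = t₁} {at A p} {t₂} {t₂}
          (Setoid.sym (𝕋 𝔹 _) {at A p} {t₁} t≈) (Setoid.refl (𝕋 𝔹 _) {t₂}) t₁⊢t₂
        (m , p′ , m′) = closed v s p r
        t = j₂ , c ⨾ e , o₂ , k₂ , act e′ z , v
    in  m , p′ , Setoid.trans (𝕋 𝔹 _) {at A p′} {t} {t₂}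
                   (Match⇒≈ (at A p′) t (Match-sym m′))
                   (refl , HomEq.trans ce≈ (identityˡ _) , O.refl , refl , q)

  -- Prefixing `d` turns a derivation between triples over `β z` into one over `transitions`:
  -- `c₁ ⨾ e ≈ c₂` gives `(d ⨾ c₁) ⨾ e ≈ d ⨾ c₂`.
  β-saturated : ∀ {k} (z : Carrier (Algebra.Sort 𝔹 k)) → Saturated C countable O T 𝔹 (β z)
  β-saturated ((S , s , d) , v) {j₁ , c₁ , ox₁} {j₂ , c₂ , ox₂} t₁∈ (e , e′ , ce≈ , r , q) =
    from (∈-H-act C countable O 𝔹 d A {j₂} {c₂} {ox₂})
      (transitions-saturated S v s {j₁ , d ⨾ c₁ , ox₁} {j₂ , d ⨾ c₂ , ox₂}
        (to (∈-H-act C countable O 𝔹 d A {j₁} {c₁} {ox₁}) t₁∈)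
        ( e , e′
        , HomEq.trans (assoc _ _ _) (HomEq.trans (⨾-cong HomEq.refl (HomEq.trans ce≈ (identityˡ _)))
            (HomEq.sym (identityˡ _)))
        , r , q))
    where A = transitions S v s

  𝔹-coalgebra : Category.Obj (CoalgHᴵ C countable O T)
  𝔹-coalgebra = ⟨ 𝔹 , 𝔹-structure ⟩ ,
    record
      { map     = record
        { to   = λ z → β z , λ {t₁} {t₂} → β-saturated z {t₁} {t₂}
        ; cong = λ {z} {z′} → Func.cong (map 𝔹-structure) {z} {z′}
        }
      -- On saturated sets the action of `S` agrees with that of `H`; this is naturality of `ι`.
      ; natural = λ e z →
          let H-βz = H-act C countable O 𝔹 e (β z)
              S-βz = S-act C countable O T 𝔹 e (β z)
          in  Setoid.trans (G C countable O 𝔹 _) {β (Algebra.op 𝔹 e ⟨$⟩ z)} {H-βz} {S-βz}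
            (natural 𝔹-structure e z)
            (Setoid.sym (G C countable O 𝔹 _) {S-βz} {H-βz}
              (natural (ι C countable O T 𝔹) e (β z , λ {t₁} {t₂} → β-saturated z {t₁} {t₂})))
      } ,
    λ z → Setoid.refl (G C countable O 𝔹 _) {β z}

  -- Unravelling a coalgebra into finite paths.

  module Unravelling (X : Algebra C) (structure : Homomorphism C X (H.F₀ X)) where
    open Algebra X using (Sort; op; op-id; op-resp; _≋_; module SortEq)

    private
      module T {i} = Setoid (𝕋 X i)

      α : ∀ {i} → Carrier (Sort i) → CountableSubset ℓ (𝕋 X i)
      α x = map structure ⟨$⟩ x

    graph : Graph (suc ℓ)
    graph = record
      { Node   = Carrier ∘ Sort
      ; Branch = λ x → ∃[ n ] Dom (α x) n
      ; target = λ x (_ , p) → at (α x) p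
      }

    infix 4 _≃_

    -- This relation serves both existence and uniqueness: a homomorphism to `𝔹` is a coalgebra
    -- morphism exactly when it sends each `x` to a behaviour related to `x`, and two behaviours
    -- related to one `x` are bisimilar.
    _≃_ : ∀ {k} → Behaviour k → Carrier (Sort k) → Set ℓ
    _≃_ = Bisimilar behaviours graph

    private
      IsMorphism : Homomorphism C X 𝔹 → Set (suc ℓ)
      IsMorphism = IsCoalgebraMorphism (H C countable O) ⟨ X , structure ⟩ (proj₁ 𝔹-coalgebra)

      ≃-join : ∀ {k} {z z′ : Behaviour k} {x} → z ≃ x → z′ ≃ x → z ∼ z′
      ≃-join r r′ = Bisimilar-trans behaviours graph behaviours r (Bisimilar-sym behaviours graph r′)

      Match-join : ∀ {i} {t t′ : Labelled Behaviour i} {u : Carrier (𝕋 X i)} →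
                   Match _≃_ t u → Match _≃_ t′ u → Match _∼_ t t′
      Match-join m m′ = Match-map _ _∼_ (λ (_ , r , r′) → ≃-join r r′)
        (Match-compose _≃_ (λ x z → z ≃ x) m (Match-flip _≃_ m′))

    -- The finite paths from x₀ form a small set, although the carrier of X is large.
    module _ {i₀} (x₀ : Carrier (Sort i₀)) where

      data Path : Set ℓ
      end : Path → Σ Obj (Carrier ∘ Sort)

      data Path where
        []  : Path
        _▷_ : ∀ (π : Path) {n} → Dom (α (proj₂ (end π))) n → Path

      end []      = i₀ , x₀
      end (π ▷ p) = let (_ , _ , _ , y) = at (α (proj₂ (end π))) p in y

      paths : System
      paths = record
        { State   = Path
        ; sort    = proj₁ ∘ end
        ; Enabled = λ π → Dom (α (proj₂ (end π)))
        ; step    = λ π p → let (j , c , o , _) = at (α (proj₂ (end π))) p in j , c , o , π ▷ p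
        }

      Represents : ∀ {k} → Behaviour k → Carrier (Sort k) → Set (suc ℓ)
      Represents {k} z y =
        Σ[ π ∈ Path ] Σ[ d ∈ Arr (proj₁ (end π)) k ] z ≡ (paths , π , d) × y ≋ op d ⟨$⟩ proj₂ (end π)

      match-end : ∀ {i} {t : Carrier (𝕋 X i)} {j c o} (π : Path) → (j , c , o , end π) T.≈ t →
                  Match Represents (j , c , o , proj₁ (end π) , state paths π) t
      match-end {t = _ , _ , _ , _ , _} π (refl , c≈ , o≈ , refl , y≈) =
        match refl refl c≈ o≈ (π , id _ , refl , SortEq.trans (SortEq.sym y≈) (SortEq.sym (op-id _)))

      -- By naturality of `structure` at `d`, the transitions of `op d` applied to the end of `π`
      -- are those of the end acted upon by `d`, which are the branches of the formal instance.
      represents-step : ∀ {k} {z : Behaviour k} {y : Carrier (Sort k)} →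
                        Represents z y → Step behaviours graph Represents z y
      represents-step {y = y} (π , d , refl , y≋) =
        (λ (n , p , c , q) →
          let (m , p′ , t≈) = proj₂ αy≈ (n , p , c , q , refl) in
          (m , p′) , match-end (π ▷ p) (T.sym {x = at (α y) p′} t≈)) ,
        (λ (n , p) →
          let (_ , (n′ , p′ , c , q , _) , t≈) = proj₁ αy≈ p in
          (n′ , p′ , c , q) , match-end (π ▷ p′) t≈)
        where
        x = proj₂ (end π)

        αy≈ : Setoid._≈_ (G C countable O X _) (α y) (H-act C countable O X d (α x))
        αy≈ = Setoid.trans (G C countable O X _) {α y} {α (op d ⟨$⟩ x)} {H-act C countable O X d (α x)}
          (Func.cong (map structure) y≋) (natural structure d x)

      represents⇒≃ : ∀ {k} {z : Behaviour k} {y : Carrier (Sort k)} → Represents z y → z ≃ y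
      represents⇒≃ = coinduct behaviours graph Represents represents-step

    private
      Triple-f : Homomorphism C X 𝔹 → ∀ {i} → Carrier (𝕋 X i) → Labelled Behaviour i
      Triple-f f t = forget (Triple-map C countable O f ⟨$⟩ t)

    -- Bisimulation up to `∼`: the morphism equation identifies transitions only up to equality in
    -- `𝔹`, so the graph of `f` is closed under `∼` before coinduction.
    morphism⇒≃ : (f : Homomorphism C X 𝔹) →
                 IsMorphism f →
                 ∀ {k} (x : Carrier (Sort k)) → proj₁ (map f ⟨$⟩ x) ≃ x
    morphism⇒≃ f f-morphism x = coinduct behaviours graph FollowedBy follow ∼-refl
      where
      FollowedBy : ∀ {k} → Behaviour k → Carrier (Sort k) → Set ℓ
      FollowedBy z x = z ∼ proj₁ (map f ⟨$⟩ x)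

      reindex : ∀ {i} {t : Labelled Behaviour i} {u : Carrier (𝕋 X i)} →
                Match _∼_ t (Triple-f f u) → Match FollowedBy t u
      reindex (match p q c≈ o≈ r) = match p q c≈ o≈ r

      follow : ∀ {k} {z : Behaviour k} {x : Carrier (Sort k)} →
               FollowedBy z x → Step behaviours graph FollowedBy z x
      follow {x = x} r =
        (λ b →
          let ((n , p , c , q) , m) = proj₁ (unfold behaviours behaviours r) b
              b′ = n , p , c , q , refl
              (n′ , p′ , t≈) = proj₂ (f-morphism x) b′
          in  (n′ , p′) ,
              reindex (Match-trans m (Match-sym (≈⇒Match (at image-α p′) (at (β (map f ⟨$⟩ x)) b′) t≈)))) ,
        (λ (_ , p) →
          let (_ , b′@(n , p′ , c , q , _) , t≈) = proj₁ (f-morphism x) p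
              (b , m) = proj₂ (unfold behaviours behaviours r) (n , p′ , c , q)
          in  b , reindex (Match-trans m (≈⇒Match (at (β (map f ⟨$⟩ x)) b′) (at image-α p) t≈)))
        where
        image-α = image (Triple-map C countable O f) (α x)

    ≃⇒morphism : (f : Homomorphism C X 𝔹) → (∀ {k} (y : Carrier (Sort k)) → proj₁ (map f ⟨$⟩ y) ≃ y) →
                 IsMorphism f
    ≃⇒morphism f f≃ x =
      (λ p →
        let ((n , p′ , c , q) , m) = proj₂ (unfold behaviours graph (f≃ x)) (_ , p)
            b = n , p′ , c , q , refl
        in  _ , b , Match⇒≈ (at βfx b) (at image-α p) (apply m)) ,
      (λ b@(n , p′ , c , q , _) →
        let ((_ , p) , m) = proj₁ (unfold behaviours graph (f≃ x)) (n , p′ , c , q)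
        in  _ , p , Match⇒≈ (at image-α p) (at βfx b) (Match-sym (apply m)))
      where
      image-α = image (Triple-map C countable O f) (α x)
      βfx = β (map f ⟨$⟩ x)

      apply : ∀ {i} {t : Labelled Behaviour i} {u : Carrier (𝕋 X i)} →
              Match _≃_ t u → Match _∼_ t (Triple-f f u)
      -- The hypothesis is used at the successor in `X`: its image and the matched behaviour are
      -- both related to it, hence bisimilar.
      apply (match p q c≈ o≈ r) = match p q c≈ o≈ (≃-join r (f≃ _))

    module _ (α-saturated : ∀ {k} (x : Carrier (Sort k)) → Saturated C countable O T X (α x)) where

      -- Both fields compare behaviours through `X`. For one number, `π ▷ p` and `π ▷ q` end in
      -- equal elements; for a derived rule, saturation of `α` supplies a path ending in `op e′ y`,
      -- which the formal instance represents too.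
      paths-valid : ∀ {i₀} (x₀ : Carrier (Sort i₀)) → Valid (paths x₀)
      paths-valid x₀ = record
        { deterministic = λ π p q →
            Match-join (Match-map _ _≃_ (represents⇒≃ x₀) (match-end x₀ (π ▷ p) (functional (α _) p q)))
                       (Match-map _ _≃_ (represents⇒≃ x₀) (match-end x₀ (π ▷ q) T.refl))
        ; closed = λ π p {j′} {k′} {o′} {e} {e′} r →
            let (j , c , o , k , y) = at (α (proj₂ (end x₀ π))) p
                t = j′ , c ⨾ e , o′ , k′ , op e′ ⟨$⟩ y
                (m , q , t≈) = α-saturated (proj₂ (end x₀ π)) {_} {t} (at-∈ (α _) p)
                                 (e , e′ , HomEq.sym (identityˡ _) , r , SortEq.refl)
            in  m , q , Match-join {u = t}
                  (match refl refl HomEq.refl O.refl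
                    (represents⇒≃ x₀ (π ▷ p , _ , refl , op-resp (HomEq.sym (identityˡ e′)) y)))
                  (Match-map _ _≃_ (represents⇒≃ x₀) (match-end x₀ (π ▷ q) t≈))
        }

      behaviour : ∀ {k} → Carrier (Sort k) → Behaviour k
      behaviour x = state (paths x) []

      behaviour≃ : ∀ {k} (x : Carrier (Sort k)) {y} → y ≋ x → behaviour x ≃ y
      behaviour≃ x y≋x = represents⇒≃ x ([] , id _ , refl , SortEq.trans y≋x (SortEq.sym (op-id x)))

      unravel : Homomorphism C X 𝔹
      unravel = record
        { map     = record
          { to   = λ x → behaviour x , paths-valid x
          ; cong = λ {x} {y} x≋y → ≃-join (behaviour≃ x (SortEq.sym x≋y)) (behaviour≃ y SortEq.refl)
          }
        -- One side unravels `op c x` afresh, the other is a formal instance of the unravelling of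
        -- `x`; both are related to `op c x`.
        ; natural = λ c x → ≃-join (behaviour≃ (op c ⟨$⟩ x) SortEq.refl)
            (represents⇒≃ x ([] , id _ ⨾ c , refl , op-resp (HomEq.sym (identityˡ c)) x))
        }

      unravel-morphism : IsMorphism unravel
      unravel-morphism = ≃⇒morphism unravel (λ x → behaviour≃ x SortEq.refl)

      unravel-unique : (f : Homomorphism C X 𝔹) →
                       IsMorphism f →
                       f Alg.≈ unravel
      unravel-unique f f-morphism x = ≃-join (morphism⇒≃ f f-morphism x) (behaviour≃ x SortEq.refl)

  -- Finality.

  structure-saturated : ((⟨ X , α ⟩ , _) : Category.Obj (CoalgHᴵ C countable O T)) →
                        ∀ {k} (x : Carrier (Algebra.Sort X k)) → Saturated C countable O T X (map α ⟨$⟩ x)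
  structure-saturated (⟨ X , α ⟩ , α′ , α≈) x t₁∈ t₁⊢t₂ =
    let (A , A-saturated) = map α′ ⟨$⟩ x in
    ⊆⇒ A (map α ⟨$⟩ x) (proj₂ (α≈ x)) _ (A-saturated (⊆⇒ (map α ⟨$⟩ x) A (proj₁ (α≈ x)) _ t₁∈) t₁⊢t₂)

theoremD6 : ∀ {ℓ : Level} (C : Category ℓ ℓ ℓ) (countable : Countable (arrows C))
    (O : Setoid ℓ ℓ) (T : InferenceSystem C O) →
    FinalObject (CoalgHᴵ C countable O T)
theoremD6 C countable O T = record
  { ⊤        = 𝔹-coalgebra
  ; !        = λ { 𝕏@(⟨ X , α ⟩ , _) → let open Unravelling X α in
      unravel (structure-saturated 𝕏) , unravel-morphism (structure-saturated 𝕏) }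
  ; !-unique = λ { {𝕏@(⟨ X , α ⟩ , _)} (f , f-morphism) → let open Unravelling X α in
      unravel-unique (structure-saturated 𝕏) f f-morphism }
  }
  where open FinalCoalgebra C countable O T
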